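{- If a sequent $\Gamma\Rightarrow\Delta$ is provable in $\mathsf{Grz}_\infty$, then there is a cyclic proof of $\Gamma\Rightarrow\Delta$.
   Context: Formulas are built from $\bot$ and atomic propositions using $\to$ and $\Box$. A sequent is $\Gamma\Rightarrow\Delta$ with $\Gamma,\Delta$ finite multisets of formulas; $\Box\Pi$ denotes $\{\Box B: B\in\Pi\}$ as a multiset. The calculus $\mathsf{Grz}_\infty$ has initial sequents $\Gamma,p\Rightarrow p,\Delta$ ($p$ atomic) and $\Gamma,\bot\Rightarrow\Delta$ and rules: $(\to_L)$ from $\Gamma,B\Rightarrow\Delta$ and $\Gamma\Rightarrow A,\Delta$ infer $\Gamma,A\to B\Rightarrow\Delta$; $(\to_R)$ from $\Gamma,A\Rightarrow B,\Delta$ infer $\Gamma\Rightarrow A\to B,\Delta$; $(\mathsf{refl})$ from $\Gamma,B,\Box B\Rightarrow\Delta$ infer $\Gamma,\Box B\Rightarrow\Delta$; $(\Box)$ from left premise $\Gamma,\Box\Pi\Rightarrow A,\Delta$ and right premise $\Box\Pi\Rightarrow A$ infer $\Gamma,\Box\Pi\Rightarrow\Box A,\Delta$. An $\infty$-proof is a possibly infinite tree of sequents built according to these rules, with leaves labelled by initial sequents, in which every infinite branch passes through a right premise of $(\Box)$ infinitely often; a sequent is provable if it labels the root of an $\infty$-proof. A cyclic proof of $\Gamma\Rightarrow\Delta$ is a pair $(\kappa,d)$ where $\kappa$ is a finite tree of sequents constructed according to the rules of $\mathsf{Grz}_\infty$ with root labelled $\Gamma\Rightarrow\Delta$ (leaves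 need not be initial sequents), and $d$ is a function defined exactly on the leaves of $\kappa$ not labelled by initial sequents such that for each such leaf $a$: $d(a)$ lies on the path from the root of $\kappa$ to $a$; there is a right premise of the rule $(\Box)$ between $a$ and $d(a)$; and $a$ and $d(a)$ are labelled by the same sequent. -}

module Defs where

open import Data.List using (List; []; _∷_; _++_; _∷ʳ_; map; length)
open import Data.List.Relation.Binary.Permutation.Propositional using (_↭_)
open import Data.Maybe using (Maybe; just; nothing; Is-just)
open import Data.Nat using (ℕ; zero; suc; _≤_)
open import Data.Product using (∃-syntax; _×_)
open import Data.Sum using (_⊎_)
open import Function.Bundles using (_⇔_)
open import Relation.Binary.PropositionalEquality using (_≡_; _≢_)
open import Relation.Nullary using (¬_)

infixr 7 _⊃_
infixr 8 □_
infix  4 _⇒_ _≋_ _∈_ _≼_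

data Formula : Set where
  ⊥ᶠ   : Formula
  atom : ℕ → Formula
  _⊃_  : Formula → Formula → Formula
  □_   : Formula → Formula

-- Finite multisets are lists considered up to permutation: two sequents are
-- the same when they are related by _≋_.
record Sequent : Set where
  constructor _⇒_
  field
    ante : List Formula
    succ : List Formula

_≋_ : Sequent → Sequent → Set
(Γ ⇒ Δ) ≋ (Γ′ ⇒ Δ′) = (Γ ↭ Γ′) × (Δ ↭ Δ′)

-- A node is identified with the path of moves leading to it from the root,
-- first move first; the premises of the node a are a ∷ʳ left and a ∷ʳ right.
-- The premise of a one-premise rule is the left one.
data Dir : Set where
  left right : Dir

Node : Set
Node = List Dir

-- A possibly infinite tree of sequents: a prefix-closed partial labelling.
record Tree : Set where
  field
    label  : Node → Maybe Sequent
    closed : ∀ a i → Is-just (label (a ∷ʳ i)) → Is-just (label a)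

open Tree public

_∈_ : Node → Tree → Set
a ∈ t = Is-just (label t a)

Labelled : Tree → Node → Sequent → Set
Labelled t a S = ∃[ S′ ] (label t a ≡ just S′ × S′ ≋ S)

Leaf : Tree → Node → Set
Leaf t a = a ∈ t × (∀ i → ¬ (a ∷ʳ i ∈ t))

data InitialAt (t : Tree) (a : Node) : Set where
  ax  : ∀ {Γ Δ} p → Labelled t a (atom p ∷ Γ ⇒ atom p ∷ Δ) → InitialAt t a
  bot : ∀ {Γ Δ} → Labelled t a (⊥ᶠ ∷ Γ ⇒ Δ) → InitialAt t a

data Rule : Set where
  →L →R refl box : Rule

-- RuleAt t a r: the label of a follows by the rule r from the labels of the
-- children of a.
data RuleAt (t : Tree) (a : Node) : Rule → Set where
  →L   : ∀ {Γ Δ A B} →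
         Labelled t (a ∷ʳ left)  (B ∷ Γ ⇒ Δ) →
         Labelled t (a ∷ʳ right) (Γ ⇒ A ∷ Δ) →
         Labelled t a ((A ⊃ B) ∷ Γ ⇒ Δ) →
         RuleAt t a →L
  →R   : ∀ {Γ Δ A B} →
         Labelled t (a ∷ʳ left) (A ∷ Γ ⇒ B ∷ Δ) →
         ¬ (a ∷ʳ right ∈ t) →
         Labelled t a (Γ ⇒ (A ⊃ B) ∷ Δ) →
         RuleAt t a →R
  refl : ∀ {Γ Δ B} →
         Labelled t (a ∷ʳ left) (B ∷ □ B ∷ Γ ⇒ Δ) →
         ¬ (a ∷ʳ right ∈ t) →
         Labelled t a (□ B ∷ Γ ⇒ Δ) →
         RuleAt t a refl
  box  : ∀ {Γ Δ Π A} →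
         Labelled t (a ∷ʳ left)  (Γ ++ map □_ Π ⇒ A ∷ Δ) →
         Labelled t (a ∷ʳ right) (map □_ Π ⇒ A ∷ []) →
         Labelled t a (Γ ++ map □_ Π ⇒ □ A ∷ Δ) →
         RuleAt t a box

-- Leaves are unrestricted here.
Constructed : Tree → Set
Constructed t = ∀ a → a ∈ t → Leaf t a ⊎ (∃[ r ] RuleAt t a r)

RightPremise : Tree → Node → Set
RightPremise t b = ∃[ a ] (b ≡ a ∷ʳ right × RuleAt t a box)

-- The node reached after n moves along an infinite sequence of moves.
_↾_ : (ℕ → Dir) → ℕ → Node
β ↾ zero  = []
β ↾ suc n = (β ↾ n) ∷ʳ β n

InfiniteBranch : Tree → (ℕ → Dir) → Set
InfiniteBranch t β = ∀ n → β ↾ n ∈ t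

record ∞Proof (S : Sequent) : Set where
  field
    tree        : Tree
    root        : Labelled tree [] S
    constructed : Constructed tree
    leaves      : ∀ a → Leaf tree a → InitialAt tree a
    progress    : ∀ β → InfiniteBranch tree β →
                  ∀ n → ∃[ m ] (n ≤ m × RightPremise tree (β ↾ m))

-- b ≼ a: the node b lies on the path from the root to a.
_≼_ : Node → Node → Set
b ≼ a = ∃[ c ] (a ≡ b ++ c)

-- Trees are binary branching, so finiteness is bounded height.
Finite : Tree → Set
Finite t = ∃[ n ] (∀ a → a ∈ t → length a ≤ n)

-- A right premise c between d(a) = b and a means that the step into c is one
-- of the steps from b to a: c may be a itself but not b.
record CyclicProof (S : Sequent) : Set where
  field
    κ           : Tree
    finite      : Finite κ
    root        : Labelled κ [] S
    constructed : Constructed κ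
    d           : Node → Maybe Node
    domain      : ∀ a → Is-just (d a) ⇔ (Leaf κ a × ¬ InitialAt κ a)
    onPath      : ∀ a b → d a ≡ just b → b ≼ a
    between     : ∀ a b → d a ≡ just b →
                  ∃[ c ] (b ≼ c × b ≢ c × c ≼ a × RightPremise κ c)
    sameLabel   : ∀ a b → d a ≡ just b →
                  ∃[ S′ ] (Labelled κ a S′ × Labelled κ b S′)

Provable : Sequent → Set
Provable S = ∞Proof S

{-# OPTIONS --safe #-}

-- A terminating backward proof search turns every sequent into either a derivation
-- with back links or a finite tree that is a Kripke countermodel.  The search closes
-- a right premise □Π ⇒ A of the box rule by a back link as soon as the same pair (Π , A)
-- occurs as a right premise below it; Π is kept a sublist of the list of subformulas, so
-- only finitely many pairs exist.  The sequent of an ∞-proof has no countermodel: from one,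
-- compute a branch of refuted sequents, moving to a strictly smaller subtree at each
-- right premise of the box rule; such a branch has only finitely many right premises.  Thus
-- compactness (König's lemma) for the ∞-proof is avoided and the argument is constructive.

module Submission where

open import Defs
open import Data.Empty using (⊥; ⊥-elim)
open import Data.List using
  (List; []; _∷_; _++_; _∷ʳ_; map; foldl; length; filter; concatMap; deduplicate; cartesianProduct)
import Data.List.Properties as List
open import Data.List.Properties using
  (∷ʳ-injective; foldl-∷ʳ; ++-assoc; ++-identityʳ; length-++; map-++)
open import Data.List.Membership.Propositional using () renaming (_∈_ to _∈ˡ_)
open import Data.List.Membership.Propositional.Properties using
  (∈-++⁺ˡ; ∈-++⁺ʳ; ∈-++⁻; ∈-map⁺; ∈-filter⁺; ∈-filter⁻; ∈-deduplicate⁺; ∈-deduplicate⁻; ∈-cartesianProduct⁺)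
open import Data.List.Membership.DecPropositional using () renaming (_∈?_ to member?)
open import Data.List.Relation.Unary.All as All using (All; []; _∷_)
open import Data.List.Relation.Unary.All.Properties using (All¬⇒¬Any; ++⁻ˡ; ++⁻ʳ; map⁺)
open import Data.List.Relation.Unary.AllPairs using ([]; _∷_)
open import Data.List.Relation.Unary.Any using (Any; here; there)
open import Data.List.Relation.Unary.Unique.Propositional using (Unique)
import Data.List.Relation.Unary.Unique.Propositional.Properties as Unique
open import Data.List.Relation.Unary.Unique.DecPropositional.Properties using (deduplicate-!)
open import Data.List.Relation.Binary.Permutation.Propositional using
  (_↭_; ↭-sym; ↭-trans; ↭-refl; ↭-reflexive; prep; swap)
open import Data.List.Relation.Binary.Permutation.Propositional.Properties using
  (All-resp-↭; ∈-resp-↭; shift; ++⁺ˡ; ++⁺ʳ) renaming (map⁺ to ↭-map⁺)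
open import Data.Maybe as Maybe using (Maybe; just; nothing; Is-just; maybe′; _>>=_)
open import Data.Maybe.Relation.Unary.Any using (just)
open import Data.Nat using (ℕ; zero; suc; _+_; _⊔_; _≤_; _<_; z≤n; s≤s)
open import Data.Nat.ListAction using (sum)
open import Data.Nat.ListAction.Properties using (sum-↭)
open import Data.Nat.Properties
open import Data.Nat.Tactic.RingSolver using (solve-∀)
open import Data.Product using (∃-syntax; _×_; _,_; proj₁; proj₂; uncurry)
open import Data.Product.Properties using (≡-dec)
open import Data.Sum using (_⊎_; inj₁; inj₂; [_,_]′)
open import Data.Unit using (tt)
open import Function using (_∘_)
open import Function.Bundles using (mk⇔)
open import Relation.Binary.Definitions using (DecidableEquality)
open import Relation.Binary.PropositionalEquality using (_≡_; _≢_; refl; sym; trans; cong; cong₂; subst)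
open import Relation.Nullary using (¬_; Dec; yes; no)
open import Relation.Nullary.Decidable using (map′; _×-dec_)

-- Kripke countermodels

data World : Set where
  world : List ℕ → List World → World

children : World → List World
children (world _ ws) = ws

-- Accessibility is the reflexive descendant relation of a finite tree, so the models are finite
-- partial orders, as suits Grz.
data Box (P : World → Set) : World → Set where
  box : ∀ {V ws} → P (world V ws) → All (Box P) ws → Box P (world V ws)

infix 4 _⊩_ _⊮_

_⊩_ : World → Formula → Set
w          ⊩ ⊥ᶠ     = ⊥
world V ws ⊩ atom p = p ∈ˡ V
w          ⊩ A ⊃ B  = w ⊩ A → w ⊩ B
w          ⊩ □ A    = Box (_⊩ A) w

_⊮_ : World → Formula → Set
w ⊮ A = ¬ (w ⊩ A)

size  : World → ℕ
sizes : List World → ℕ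
size (world _ ws) = suc (sizes ws)
sizes []          = 0
sizes (w ∷ ws)    = size w + sizes ws

-- This is what refuting the right premise of the box rule takes: the boxed formulas survive at
-- `target`, and the size bound later excludes infinitely many such moves.
record Escape (P : World → Set) (n : ℕ) (Q : Formula → Set) : Set where
  field
    target : World
    lower  : size target < n
    keeps  : ∀ {B} → Q B → target ⊩ □ B
    fails  : ¬ P target

open Escape

box⇒ : ∀ {P w} → Box P w → P w
box⇒ (box p _) = p

box⇒children : ∀ {P V ws} → Box P (world V ws) → All (Box P) ws
box⇒children (box _ ps) = ps

module _ {P : World → Set} (P? : ∀ w → Dec (P w)) where

  -- The two ways for a box to fail select a premise of the box rule: failure at `w` itself refutes
  -- the left one, failure at a proper descendant refutes the right one in a smaller tree.
  search-box  : ∀ w → Box P w ⊎ (¬ P w ⊎ Escape P (size w) (λ B → w ⊩ □ B))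
  search-all  : ∀ ws → All (Box P) ws ⊎ Escape P (suc (sizes ws)) (λ B → All (_⊩ □ B) ws)

  search-box w@(world V ws) with P? w
  ... | no ¬p = inj₂ (inj₁ ¬p)
  ... | yes p with search-all ws
  ...   | inj₁ ps = inj₁ (box p ps)
  ...   | inj₂ e  = inj₂ (inj₂ record
          { target = target e ; lower = lower e
          ; keeps = λ b → keeps e (box⇒children b) ; fails = fails e })

  search-all [] = inj₁ []
  search-all (w ∷ ws) with search-box w
  ... | inj₂ (inj₁ ¬p) = inj₂ record
          { target = w ; lower = s≤s (m≤m+n _ _) ; keeps = All.head ; fails = ¬p }
  ... | inj₂ (inj₂ e) = inj₂ record
          { target = target e ; lower = ≤-trans (lower e) (m≤n⇒m≤1+n (m≤m+n _ _))
          ; keeps = λ bs → keeps e (All.head bs) ; fails = fails e }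
  ... | inj₁ p with search-all ws
  ...   | inj₁ ps = inj₁ (p ∷ ps)
  ...   | inj₂ e  = inj₂ record
          { target = target e ; lower = ≤-trans (lower e) (s≤s (m≤n+m _ (size w)))
          ; keeps = λ bs → keeps e (All.tail bs) ; fails = fails e }

_⊩?_ : ∀ w A → Dec (w ⊩ A)
w          ⊩? ⊥ᶠ     = no λ ()
world V ws ⊩? atom p = member? _≟_ p V
w          ⊩? (A ⊃ B) with w ⊩? A | w ⊩? B
... | _     | yes b = yes λ _ → b
... | no ¬a | no _  = yes λ a → ⊥-elim (¬a a)
... | yes a | no ¬b = no λ f → ¬b (f a)
w          ⊩? (□ A) with search-box (_⊩? A) w
... | inj₁ b         = yes b
... | inj₂ (inj₁ ¬a) = no λ b → ¬a (box⇒ b)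
-- `keeps` for `A` itself would carry `□ A` down to the target, where `A` fails.
... | inj₂ (inj₂ e)  = no λ b → fails e (box⇒ (keeps e b))

-- Soundness of infinite proofs for finite tree models

Refutes : World → Sequent → Set
Refutes w (Γ ⇒ Δ) = All (w ⊩_) Γ × All (w ⊮_) Δ

Refutes-resp : ∀ {w S S′} → S ≋ S′ → Refutes w S → Refutes w S′
Refutes-resp (π , ρ) (γ , δ) = All-resp-↭ π γ , All-resp-↭ ρ δ

-- A box counts two because the search pays for it twice: when `□ A` moves from `R` to `Σ`, where it
-- counts `suc (weight A)`, and when `A` returns to `R`.
weight : Formula → ℕ
weight ⊥ᶠ       = 1
weight (atom _) = 1
weight (A ⊃ B)  = suc (weight A + weight B)
weight (□ A)    = suc (suc (weight A))

weights : List Formula → ℕ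
weights Γ = sum (map weight Γ)

weights-↭ : ∀ {Γ Γ′} → Γ ↭ Γ′ → weights Γ ≡ weights Γ′
weights-↭ π = sum-↭ (↭-map⁺ weight π)

RefutesAt : World → Tree → Node → Set
RefutesAt w t a = ∃[ S ] (label t a ≡ just S × Refutes w S)

module _ {t : Tree} where

  labelled-≋ : ∀ {a Γ Δ Γ′ Δ′} → Labelled t a (Γ ⇒ Δ) → Labelled t a (Γ′ ⇒ Δ′) →
               (Γ ↭ Γ′) × (Δ ↭ Δ′)
  labelled-≋ (_ , e , π , ρ) (_ , e′ , π′ , ρ′) with trans (sym e) e′
  ... | refl = ↭-trans (↭-sym π) π′ , ↭-trans (↭-sym ρ) ρ′

  refutesAt⇒ : ∀ {w a Γ Δ} → Labelled t a (Γ ⇒ Δ) → RefutesAt w t a → Refutes w (Γ ⇒ Δ)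
  refutesAt⇒ (_ , e , π) (_ , e′ , r) with trans (sym e) e′
  ... | refl = Refutes-resp π r

  ⇒refutesAt : ∀ {w a Γ Δ} → Labelled t a (Γ ⇒ Δ) → Refutes w (Γ ⇒ Δ) → RefutesAt w t a
  ⇒refutesAt (S , e , π , ρ) r = S , e , Refutes-resp (↭-sym π , ↭-sym ρ) r

  initial-valid : ∀ {w a} → InitialAt t a → ¬ RefutesAt w t a
  initial-valid (ax p l) r with refutesAt⇒ l r
  ... | (a ∷ _) , (¬a ∷ _) = ¬a a
  initial-valid (bot l) r with refutesAt⇒ l r
  ... | (() ∷ _) , _

  -- `RightPremise` accepts any reading of the labels as the box rule, so the right premise of `→L`
  -- must be kept from counting. The left premise of `box` has the antecedent of the conclusion,
  -- whereas that of `→L` trades `A ⊃ B` for the lighter `B`.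
  →L≢box : ∀ {a} → RuleAt t a →L → ¬ RuleAt t a box
  →L≢box (→L {Γ} {Δ} {A} {B} l _ c) (box l′ _ c′) = m≢1+n+m (weight B) {weight A}
    (+-cancelʳ-≡ (weights Γ) _ _ (trans (weights-↭ (proj₁ (labelled-≋ l l′)))
      (weights-↭ (proj₁ (labelled-≋ c′ c)))))

  left-not-right : ∀ {a} → ¬ RightPremise t (a ∷ʳ left)
  left-not-right {a} (b , e , _) with ∷ʳ-injective a b e
  ... | _ , ()

  record Next (a : Node) (w : World) : Set where
    field
      dir     : Dir
      next    : World
      refuted : RefutesAt next t (a ∷ʳ dir)
      size-≤  : size next ≤ size w
      size-<  : RightPremise t (a ∷ʳ dir) → size next < size w

  next-left : ∀ {a w Γ Δ} → Labelled t (a ∷ʳ left) (Γ ⇒ Δ) → Refutes w (Γ ⇒ Δ) → Next a w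
  next-left {a} {w} l r = record
    { dir = left ; next = w ; refuted = ⇒refutesAt l r ; size-≤ = ≤-refl
    ; size-< = λ p → ⊥-elim (left-not-right {a} p) }

  -- Since forcing is decidable, a refuted conclusion determines a refuted premise by computation.
  -- The world changes only at the right premise of `box`, where it shrinks.
  next : ∀ {a w r} → RuleAt t a r → RefutesAt w t a → Next a w
  next {a} {w} ρ@(→L {A = A} l r c) f with refutesAt⇒ c f
  ... | (ab ∷ γ) , δ with w ⊩? A
  ...   | yes α = next-left {a} l ((ab α ∷ γ) , δ)
  ...   | no ¬α = record
          { dir = right ; next = w ; refuted = ⇒refutesAt r (γ , (¬α ∷ δ)) ; size-≤ = ≤-refl
          ; size-< = λ (b , e , ρ′) → ⊥-elim (→L≢box ρ (subst (λ x → RuleAt t x box) (sym (proj₁ (∷ʳ-injective a b e))) ρ′)) }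
  next {a} {w} (→R {A = A} l _ c) f with refutesAt⇒ c f
  ... | γ , (¬ab ∷ δ) with w ⊩? A
  ...   | yes α = next-left {a} l ((α ∷ γ) , ((λ b → ¬ab λ _ → b) ∷ δ))
  ...   | no ¬α = ⊥-elim (¬ab λ α → ⊥-elim (¬α α))
  next {a} (refl l _ c) f with refutesAt⇒ c f
  ... | (b ∷ γ) , δ = next-left {a} l ((box⇒ b ∷ b ∷ γ) , δ)
  next {a} {w} (box {Γ = Γ} {Π = Π} {A = A} l r c) f with refutesAt⇒ c f
  ... | γ , (¬a ∷ δ) with search-box (_⊩? A) w
  ...   | inj₁ b         = ⊥-elim (¬a b)
  ...   | inj₂ (inj₁ ¬α) = next-left {a} l (γ , (¬α ∷ δ))
  ...   | inj₂ (inj₂ e)  = record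
          { dir = right ; next = target e
          ; refuted = ⇒refutesAt r (keep Π (++⁻ʳ Γ γ) , (fails e ∷ []))
          ; size-≤ = <⇒≤ (lower e) ; size-< = λ _ → lower e }
    where
      keep : ∀ Π → All (w ⊩_) (map □_ Π) → All (target e ⊩_) (map □_ Π)
      keep []      []       = []
      keep (B ∷ Π) (b ∷ bs) = keeps e b ∷ keep Π bs

module _ {S : Sequent} (π : ∞Proof S) where
  open ∞Proof π

  Refuted : Node → Set
  Refuted a = ∃[ w ] RefutesAt w tree a

  -- Initial sequents have no countermodel, so a refuted node is no leaf and some rule applies to
  -- it.
  advance : ∀ a (r : Refuted a) → Next {tree} a (proj₁ r)
  advance a (w , r@(_ , e , _)) with constructed a (subst Is-just (sym e) (just tt))
  ... | inj₁ leaf    = ⊥-elim (initial-valid (leaves a leaf) r)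
  ... | inj₂ (_ , ρ) = next ρ r

  module _ (r₀ : Refuted []) where

    walk   : ℕ → ∃[ a ] Refuted a
    walk zero    = [] , r₀
    walk (suc n) = let a , r = walk n ; s = advance a r in
                   a ∷ʳ Next.dir s , Next.next s , Next.refuted s

    step : ∀ n → let a , r = walk n in Next a (proj₁ r)
    step n = advance (proj₁ (walk n)) (proj₂ (walk n))

    β : ℕ → Dir
    β n = Next.dir (step n)

    β↾ : ∀ n → β ↾ n ≡ proj₁ (walk n)
    β↾ zero    = refl
    β↾ (suc n) = cong (_∷ʳ β n) (β↾ n)

    infinite : InfiniteBranch tree β
    infinite n = subst (_∈ tree) (sym (β↾ n))
      (let _ , _ , _ , e , _ = walk n in subst Is-just (sym e) (just tt))

    h : ℕ → ℕ
    h n = size (proj₁ (proj₂ (walk n)))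

    h-mono : ∀ {m n} → m ≤ n → h n ≤ h m
    h-mono {m} {n} m≤n with m≤n⇒m<n∨m≡n m≤n
    ... | inj₂ refl = ≤-refl
    h-mono {m} {suc n} _ | inj₁ (s≤s m≤n) = ≤-trans (Next.size-≤ (step n)) (h-mono m≤n)

    -- World sizes never grow along the branch and drop at every right premise of `box`; as
    -- `progress` always supplies a later one, induction on the bound `k` gives a contradiction.
    no-descent : ∀ k n → ¬ (h n < k)
    no-descent zero    n ()
    -- Asking for an index of at least `suc n` makes it a successor `suc m`, so that `step m` is the
    -- move into the right premise and comes no earlier than `n`.
    no-descent (suc k) n (s≤s h≤k) with progress β infinite (suc n)
    ... | suc m , s≤s n≤m , p = no-descent k (suc m) (≤-trans
      (Next.size-< (step m) (subst (RightPremise tree) (β↾ (suc m)) p))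
      (≤-trans (h-mono n≤m) h≤k))

  soundness : ∀ w → ¬ Refutes w S
  soundness w r = no-descent r₀ _ 0 ≤-refl
    where r₀ = w , ⇒refutesAt {tree} root r

-- Derivations with back links and their cyclic proofs

Key : Set
Key = List Formula × Formula

premise : Key → Sequent
premise (Π , A) = map □_ Π ⇒ A ∷ []

-- `H` collects the right premises of the box rule entered on the way from the root. `back` is an
-- instance of that rule whose right premise stays a leaf because it already occurs in `H`. The `≋`
-- in each constructor builds exchange into the rules.
data Der (H : List Key) (S : Sequent) : Set where
  ax   : ∀ {Γ Δ} p → S ≋ (atom p ∷ Γ ⇒ atom p ∷ Δ) → Der H S
  bot  : ∀ {Γ Δ} → S ≋ (⊥ᶠ ∷ Γ ⇒ Δ) → Der H S
  →L   : ∀ {Γ Δ A B} → S ≋ ((A ⊃ B) ∷ Γ ⇒ Δ) →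
         Der H (B ∷ Γ ⇒ Δ) → Der H (Γ ⇒ A ∷ Δ) → Der H S
  →R   : ∀ {Γ Δ A B} → S ≋ (Γ ⇒ (A ⊃ B) ∷ Δ) → Der H (A ∷ Γ ⇒ B ∷ Δ) → Der H S
  refl : ∀ {Γ Δ B} → S ≋ (□ B ∷ Γ ⇒ Δ) → Der H (B ∷ □ B ∷ Γ ⇒ Δ) → Der H S
  box  : ∀ {Γ Δ Π A} → S ≋ (Γ ++ map □_ Π ⇒ □ A ∷ Δ) →
         Der H (Γ ++ map □_ Π ⇒ A ∷ Δ) → Der ((Π , A) ∷ H) (premise (Π , A)) → Der H S
  back : ∀ {Γ Δ Π A} → S ≋ (Γ ++ map □_ Π ⇒ □ A ∷ Δ) →
         Der H (Γ ++ map □_ Π ⇒ A ∷ Δ) → (Π , A) ∈ˡ H → Der H S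

≋-refl : ∀ {S} → S ≋ S
≋-refl = ↭-refl , ↭-refl

exchange : ∀ {H S S′} → S ≋ S′ → Der H S′ → Der H S
exchange (π , ρ) d = go d
  where
    t : ∀ {Γ Δ} → _ ≋ (Γ ⇒ Δ) → _ ≋ (Γ ⇒ Δ)
    t (π′ , ρ′) = ↭-trans π π′ , ↭-trans ρ ρ′
    go : Der _ _ → Der _ _
    go (ax p e)     = ax p (t e)
    go (bot e)      = bot (t e)
    go (→L e d d′)  = →L (t e) d d′
    go (→R e d)     = →R (t e) d
    go (refl e d)   = refl (t e) d
    go (box e d d′) = box (t e) d d′
    go (back e d i) = back (t e) d i

height : ∀ {H S} → Der H S → ℕ
height (ax _ _)      = 0
height (bot _)       = 0
height (→L _ d d′)   = suc (height d ⊔ height d′)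
height (→R _ d)      = suc (height d)
height (refl _ d)    = suc (height d)
height (box _ d d′)  = suc (height d ⊔ height d′)
height (back _ d _)  = suc (height d)

-- The node at which each right premise in `H` was entered, to serve as the target of back links.
Env : List Key → Set
Env = All (λ _ → Node)

data Position : Set where
  der  : ∀ {H S} → Node → Env H → Der H S → Position
  loop : Key → Node → Position

move : Maybe Position → Dir → Maybe Position
move nothing _ = nothing
move (just (loop _ _)) _ = nothing
move (just (der a ε (ax _ _)))   _ = nothing
move (just (der a ε (bot _)))    _ = nothing
move (just (der a ε (→L _ d _))) left  = just (der (a ∷ʳ left) ε d)
move (just (der a ε (→L _ _ d))) right = just (der (a ∷ʳ right) ε d)
move (just (der a ε (→R _ d)))   left  = just (der (a ∷ʳ left) ε d)
move (just (der a ε (→R _ _)))   right = nothing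
move (just (der a ε (refl _ d))) left  = just (der (a ∷ʳ left) ε d)
move (just (der a ε (refl _ _))) right = nothing
move (just (der a ε (box _ d _))) left  = just (der (a ∷ʳ left) ε d)
move (just (der a ε (box _ _ d))) right = just (der (a ∷ʳ right) ((a ∷ʳ right) ∷ ε) d)
move (just (der a ε (back _ d _))) left = just (der (a ∷ʳ left) ε d)
move (just (der a ε (back {Π = Π} {A = A} _ _ i))) right = just (loop (Π , A) (All.lookup ε i))

sequentAt : Position → Sequent
sequentAt (der {S = S} _ _ _) = S
sequentAt (loop k _)          = premise k

linkOf : Position → Maybe Node
linkOf (der _ _ _) = nothing
linkOf (loop _ b)  = just b

heightAt : Position → ℕ
heightAt (der _ _ d) = height d
heightAt (loop _ _)  = 0

move-height : ∀ p i {q} → move (just p) i ≡ just q → suc (heightAt q) ≤ heightAt p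
move-height (der a ε (→L _ d d′)) left  refl = s≤s (m≤m⊔n _ _)
move-height (der a ε (→L _ d d′)) right refl = s≤s (m≤n⊔m (height d) _)
move-height (der a ε (→R _ d))    left  refl = ≤-refl
move-height (der a ε (refl _ d))  left  refl = ≤-refl
move-height (der a ε (box _ d d′)) left  refl = s≤s (m≤m⊔n _ _)
move-height (der a ε (box _ d d′)) right refl = s≤s (m≤n⊔m (height d) _)
move-height (der a ε (back _ d _)) left  refl = ≤-refl
move-height (der a ε (back _ d _)) right refl = s≤s z≤n

Just⇒ : ∀ {X : Set} {m : Maybe X} → Is-just m → ∃[ x ] m ≡ just x
Just⇒ {m = just x} _ = x , refl

⇒Just : ∀ {X : Set} {m : Maybe X} {x} → m ≡ just x → Is-just m
⇒Just refl = just tt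

module Unravel {S : Sequent} (d₀ : Der [] S) where

  at : Node → Maybe Position
  at = foldl move (just (der [] [] d₀))

  at-∷ʳ : ∀ a i → at (a ∷ʳ i) ≡ move (at a) i
  at-∷ʳ a i = foldl-∷ʳ move (just (der [] [] d₀)) i a

  -- A wrapper from which a can be inferred, unlike from the equation itself.
  record At (a : Node) (m : Maybe Position) : Set where
    constructor ⟪_⟫
    field unwrap : at a ≡ m

  unravelled : Tree
  unravelled = record
    { label  = λ a → Maybe.map sequentAt (at a)
    ; closed = λ a i → closed′ (at a) (at-∷ʳ a i)
    }
    where
      closed′ : ∀ {i m′} m → m′ ≡ move m i →
                Is-just (Maybe.map sequentAt m′) → Is-just (Maybe.map sequentAt m)
      closed′ (just _) _ _ = just tt
      closed′ nothing refl ()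

  position : ∀ a → a ∈ unravelled → ∃[ p ] At a (just p)
  position a j with at a in e | j
  ... | just p | _ = p , ⟪ e ⟫

  labelled : ∀ {a p S′} → At a (just p) → sequentAt p ≋ S′ → Labelled unravelled a S′
  labelled ⟪ e ⟫ π = _ , cong (Maybe.map sequentAt) e , π

  inhabited : ∀ {a p} → At a (just p) → a ∈ unravelled
  inhabited ⟪ e ⟫ = ⇒Just (cong (Maybe.map sequentAt) e)

  child : ∀ {a p} i {m} → At a (just p) → move (just p) i ≡ m → At (a ∷ʳ i) m
  child {a} i ⟪ e ⟫ s = ⟪ trans (at-∷ʳ a i) (trans (cong (λ m → move m i) e) s) ⟫

  absent : ∀ {a} → At a (nothing) → ¬ (a ∈ unravelled)
  absent {a} ⟪ e ⟫ j with position a j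
  ... | _ , ⟪ e′ ⟫ with trans (sym e) e′
  ...   | ()

  leaf-or-rule : ∀ a p → At a (just p) → Leaf unravelled a ⊎ (∃[ r ] RuleAt unravelled a r)
  leaf-or-rule a (loop _ _) e = inj₁ (inhabited e , λ i → absent (child i e refl))
  leaf-or-rule a (der _ _ (ax _ _)) e = inj₁ (inhabited e , λ i → absent (child i e refl))
  leaf-or-rule a (der _ _ (bot _)) e = inj₁ (inhabited e , λ i → absent (child i e refl))
  leaf-or-rule a (der _ _ (→L π _ _)) e = inj₂ (_ , →L
    (labelled (child left e refl) ≋-refl) (labelled (child right e refl) ≋-refl) (labelled e π))
  leaf-or-rule a (der _ _ (→R π _)) e = inj₂ (_ , →R
    (labelled (child left e refl) ≋-refl) (absent (child right e refl)) (labelled e π))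
  leaf-or-rule a (der _ _ (refl π _)) e = inj₂ (_ , refl
    (labelled (child left e refl) ≋-refl) (absent (child right e refl)) (labelled e π))
  leaf-or-rule a (der _ _ (box π _ _)) e = inj₂ (_ , box
    (labelled (child left e refl) ≋-refl) (labelled (child right e refl) ≋-refl) (labelled e π))
  leaf-or-rule a (der _ _ (back π _ _)) e = inj₂ (_ , box
    (labelled (child left e refl) ≋-refl) (labelled (child right e refl) ≋-refl) (labelled e π))

  Ancestor : Node → Key → Node → Set
  Ancestor a k b = b ≼ a × Labelled unravelled b (premise k)

  -- The invariant along paths from the root. At a `loop` it yields all that a cyclic proof asks of
  -- a back link: the leaf is itself the right premise lying in between.
  Proper : Node → Position → Set
  Proper a (der {H = H} a′ ε _) = a′ ≡ a × (∀ {k} (i : k ∈ˡ H) → Ancestor a k (All.lookup ε i))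
  Proper a (loop k b) = RightPremise unravelled a × b ≢ a × Ancestor a k b

  ≼-∷ʳ : ∀ {a b} i → b ≼ a → b ≼ a ∷ʳ i
  ≼-∷ʳ {b = b} i (c , refl) = c ∷ʳ i , ++-assoc b c _

  ≼-refl : ∀ {a} → a ≼ a
  ≼-refl = [] , sym (++-identityʳ _)

  ≼⇒length : ∀ {a b} → b ≼ a → length b ≤ length a
  ≼⇒length {b = b} (c , refl) = subst (length b ≤_) (sym (length-++ b)) (m≤m+n _ _)

  ≼⇒≢∷ʳ : ∀ {a b} i → b ≼ a → b ≢ a ∷ʳ i
  ≼⇒≢∷ʳ {a} i b≼a refl = 1+n≰n (≤-trans
    (≤-reflexive (trans (+-comm 1 _) (sym (length-++ a)))) (≼⇒length b≼a))

  below : ∀ {a k b} i → Ancestor a k b → Ancestor (a ∷ʳ i) k b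
  below i (p , l) = ≼-∷ʳ i p , l

  proper-move : ∀ a p → At a (just p) → Proper a p →
                ∀ i {q} → move (just p) i ≡ just q → Proper (a ∷ʳ i) q
  proper-move a (der _ ε (→L _ d d′)) e (refl , ok) left  refl = refl , λ j → below left (ok j)
  proper-move a (der _ ε (→L _ d d′)) e (refl , ok) right refl = refl , λ j → below right (ok j)
  proper-move a (der _ ε (→R _ d))    e (refl , ok) left  refl = refl , λ j → below left (ok j)
  proper-move a (der _ ε (refl _ d))  e (refl , ok) left  refl = refl , λ j → below left (ok j)
  proper-move a (der _ ε (box _ d d′)) e (refl , ok) left  refl = refl , λ j → below left (ok j)
  proper-move a (der _ ε (box _ d d′)) e (refl , ok) right refl = refl , λ where
    (here refl) → ≼-refl , labelled (child right e refl) ≋-refl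
    (there j)   → below right (ok j)
  proper-move a (der _ ε (back _ d j)) e (refl , ok) left  refl = refl , λ j → below left (ok j)
  -- The target is an ancestor of `a`, hence shorter than the new leaf and different from it.
  proper-move a (der _ ε (back π d j)) e (refl , ok) right refl =
    (a , refl , box (labelled (child left e refl) ≋-refl)
                    (labelled (child right e refl) ≋-refl) (labelled e π)) ,
    ≼⇒≢∷ʳ right (proj₁ (ok j)) , below right (ok j)

  -- Every move lowers the height of the remaining derivation, so paths are no longer than that
  -- height; this makes the unravelled tree finite.
  descend : ∀ c a p → At a (just p) → Proper a p → ∀ {q} → foldl move (just p) c ≡ just q →
            Proper (a ++ c) q × length c ≤ heightAt p
  descend [] a p e ok refl = subst (λ x → Proper x p) (sym (++-identityʳ a)) ok , z≤n
  descend (i ∷ c) a p e ok {q} s with move (just p) i in eq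
  ... | nothing = ⊥-elim (stuck c s)
    where
      stuck : ∀ c → foldl move nothing c ≢ just q
      stuck (_ ∷ c) = stuck c
  ... | just p′ with descend c (a ∷ʳ i) p′ (child i e eq) (proper-move a p e ok i eq) s
  ...   | ok′ , l = subst (λ x → Proper x q) (++-assoc a _ c) ok′ ,
                    ≤-trans (s≤s l) (move-height p i eq)

  reached : ∀ a {p} → At a (just p) → Proper a p × length a ≤ height d₀
  reached a ⟪ e ⟫ = descend a [] _ ⟪ refl ⟫ (refl , λ ()) e

  backlink : Node → Maybe Node
  backlink a = at a >>= linkOf

  backlink⇒ : ∀ a {b} → backlink a ≡ just b → ∃[ k ] At a (just (loop k b))
  backlink⇒ a e with at a in e′
  backlink⇒ a refl | just (loop k _) = k , ⟪ e′ ⟫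

  -- The antecedent of a right premise consists of boxes, while an initial sequent has an atom or
  -- `⊥ᶠ` there.
  premise-not-initial : ∀ {k a} → Labelled unravelled a (premise k) → ¬ InitialAt unravelled a
  premise-not-initial {k} {a} l ini = go ini
    where
      only-boxes : ∀ Π {A} → A ∈ˡ map □_ Π → ∃[ B ] A ≡ □ B
      only-boxes (B ∷ Π) (here refl) = B , refl
      only-boxes (B ∷ Π) (there i)   = only-boxes Π i
      go : ¬ InitialAt unravelled a
      go (ax p l′) with only-boxes (proj₁ k) (∈-resp-↭ (proj₁ (labelled-≋ {unravelled} {a} l′ l)) (here refl))
      ... | _ , ()
      go (bot l′) with only-boxes (proj₁ k) (∈-resp-↭ (proj₁ (labelled-≋ {unravelled} {a} l′ l)) (here refl))
      ... | _ , ()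

  -- Every rule application has a left child and `ax` and `bot` give initial sequents, which leaves
  -- only `loop`.
  backlink-domain : ∀ a p → At a (just p) → Leaf unravelled a → ¬ InitialAt unravelled a →
                    Is-just (linkOf p)
  backlink-domain a (loop _ _) _ _ _ = just tt
  backlink-domain a (der _ _ (ax p π)) e _ ¬i = ⊥-elim (¬i (ax p (labelled e π)))
  backlink-domain a (der _ _ (bot π)) e _ ¬i = ⊥-elim (¬i (bot (labelled e π)))
  backlink-domain a (der _ _ (→L _ _ _)) e (_ , ∄) _ = ⊥-elim (∄ left (inhabited (child left e refl)))
  backlink-domain a (der _ _ (→R _ _)) e (_ , ∄) _ = ⊥-elim (∄ left (inhabited (child left e refl)))
  backlink-domain a (der _ _ (refl _ _)) e (_ , ∄) _ = ⊥-elim (∄ left (inhabited (child left e refl)))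
  backlink-domain a (der _ _ (box _ _ _)) e (_ , ∄) _ = ⊥-elim (∄ left (inhabited (child left e refl)))
  backlink-domain a (der _ _ (back _ _ _)) e (_ , ∄) _ = ⊥-elim (∄ left (inhabited (child left e refl)))

  cyclic : CyclicProof S
  cyclic = record
    { κ           = unravelled
    ; finite      = height d₀ , λ a j → proj₂ (reached a (proj₂ (position a j)))
    ; root        = labelled {[]} ⟪ refl ⟫ ≋-refl
    ; constructed = λ a j → let p , e = position a j in leaf-or-rule a p e
    ; d           = backlink
    ; domain      = λ a → mk⇔ (to a) (λ (leaf , ¬i) → from a leaf ¬i)
    ; onPath      = λ a b e → let _ , _ , b≼a , _ = loopAt a e in b≼a
    ; between     = λ a b e → let r , b≢a , b≼a , _ = loopAt a e in a , b≼a , b≢a , ≼-refl , r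
    ; sameLabel   = λ a b e → let k , e′ = backlink⇒ a e ; _ , _ , _ , l = loopAt a e in
                              premise k , labelled e′ ≋-refl , l
    }
    where
      loopAt : ∀ a {b} (e : backlink a ≡ just b) → Proper a (loop (proj₁ (backlink⇒ a e)) b)
      loopAt a e = proj₁ (reached a (proj₂ (backlink⇒ a e)))
      to : ∀ a → Is-just (backlink a) → Leaf unravelled a × ¬ InitialAt unravelled a
      to a j with backlink⇒ a (proj₂ (Just⇒ j))
      ... | k , e = (inhabited e , λ i → absent (child i e refl)) ,
                    premise-not-initial {k} {a} (labelled e ≋-refl)
      from : ∀ a → Leaf unravelled a → ¬ InitialAt unravelled a → Is-just (backlink a)
      from a leaf ¬i with position a (proj₁ leaf)
      ... | p , ⟪ e ⟫ = subst (λ m → Is-just (m >>= linkOf)) (sym e) (backlink-domain a p ⟪ e ⟫ leaf ¬i)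

-- Proof search

infix 4 _≟ᶠ_ _≟ᵏ_

_≟ᶠ_ : DecidableEquality Formula
⊥ᶠ      ≟ᶠ ⊥ᶠ      = yes refl
⊥ᶠ      ≟ᶠ atom _  = no λ ()
⊥ᶠ      ≟ᶠ (_ ⊃ _) = no λ ()
⊥ᶠ      ≟ᶠ (□ _)   = no λ ()
atom _  ≟ᶠ ⊥ᶠ      = no λ ()
atom p  ≟ᶠ atom q  = map′ (cong atom) (λ { refl → refl }) (p ≟ q)
atom _  ≟ᶠ (_ ⊃ _) = no λ ()
atom _  ≟ᶠ (□ _)   = no λ ()
(_ ⊃ _) ≟ᶠ ⊥ᶠ      = no λ ()
(_ ⊃ _) ≟ᶠ atom _  = no λ ()
(A ⊃ B) ≟ᶠ (C ⊃ D) = map′ (uncurry (cong₂ _⊃_)) (λ { refl → refl , refl }) ((A ≟ᶠ C) ×-dec (B ≟ᶠ D))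
(_ ⊃ _) ≟ᶠ (□ _)   = no λ ()
(□ _)   ≟ᶠ ⊥ᶠ      = no λ ()
(□ _)   ≟ᶠ atom _  = no λ ()
(□ _)   ≟ᶠ (_ ⊃ _) = no λ ()
(□ A)   ≟ᶠ (□ B)   = map′ (cong □_) (λ { refl → refl }) (A ≟ᶠ B)

_≟ᵏ_ : DecidableEquality Key
_≟ᵏ_ = ≡-dec (List.≡-dec _≟ᶠ_) _≟ᶠ_

-- Sets of formulas closed under subformulas

record Closed (U : List Formula) : Set where
  field
    imp : ∀ {A B} → A ⊃ B ∈ˡ U → A ∈ˡ U × B ∈ˡ U
    nec : ∀ {A} → □ A ∈ˡ U → A ∈ˡ U

open Closed

closed-++ : ∀ {U V} → Closed U → Closed V → Closed (U ++ V)
closed-++ {U} c d .imp i with ∈-++⁻ U i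
... | inj₁ j = let a , b = c .imp j in ∈-++⁺ˡ a , ∈-++⁺ˡ b
... | inj₂ j = let a , b = d .imp j in ∈-++⁺ʳ U a , ∈-++⁺ʳ U b
closed-++ {U} c d .nec i with ∈-++⁻ U i
... | inj₁ j = ∈-++⁺ˡ (c .nec j)
... | inj₂ j = ∈-++⁺ʳ U (d .nec j)

subformulas : Formula → List Formula
subformulas ⊥ᶠ       = ⊥ᶠ ∷ []
subformulas (atom p) = atom p ∷ []
subformulas (A ⊃ B)  = (A ⊃ B) ∷ subformulas A ++ subformulas B
subformulas (□ A)    = □ A ∷ subformulas A

subformulas-self : ∀ A → A ∈ˡ subformulas A
subformulas-self ⊥ᶠ       = here refl
subformulas-self (atom _) = here refl
subformulas-self (_ ⊃ _)  = here refl
subformulas-self (□ _)    = here refl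

subformulas-closed : ∀ A → Closed (subformulas A)
subformulas-closed ⊥ᶠ .imp (here ())
subformulas-closed ⊥ᶠ .nec (here ())
subformulas-closed (atom _) .imp (here ())
subformulas-closed (atom _) .nec (here ())
subformulas-closed (A ⊃ B) .imp (here refl) =
  there (∈-++⁺ˡ (subformulas-self A)) , there (∈-++⁺ʳ (subformulas A) (subformulas-self B))
subformulas-closed (A ⊃ B) .imp (there i) =
  let a , b = closed-++ (subformulas-closed A) (subformulas-closed B) .imp i in there a , there b
subformulas-closed (A ⊃ B) .nec (there i) =
  there (closed-++ (subformulas-closed A) (subformulas-closed B) .nec i)
subformulas-closed (□ A) .imp (there i) =
  let a , b = subformulas-closed A .imp i in there a , there b
subformulas-closed (□ A) .nec (here refl) = there (subformulas-self A)
subformulas-closed (□ A) .nec (there i)   = there (subformulas-closed A .nec i)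

closed-concatMap : ∀ Γ → Closed (concatMap subformulas Γ)
closed-concatMap []      .imp ()
closed-concatMap []      .nec ()
closed-concatMap (A ∷ Γ) = closed-++ (subformulas-closed A) (closed-concatMap Γ)

⊆-concatMap : ∀ Γ → All (_∈ˡ concatMap subformulas Γ) Γ
⊆-concatMap []      = []
⊆-concatMap (A ∷ Γ) =
  ∈-++⁺ˡ (subformulas-self A) ∷ All.map (∈-++⁺ʳ (subformulas A)) (⊆-concatMap Γ)

closed-deduplicate : ∀ {U} → Closed U → Closed (deduplicate _≟ᶠ_ U)
closed-deduplicate {U} c .imp i =
  let a , b = c .imp (∈-deduplicate⁻ _≟ᶠ_ U i) in ∈-deduplicate⁺ _≟ᶠ_ a , ∈-deduplicate⁺ _≟ᶠ_ b
closed-deduplicate {U} c .nec i = ∈-deduplicate⁺ _≟ᶠ_ (c .nec (∈-deduplicate⁻ _≟ᶠ_ U i))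

-- Sublists, submultisets and counting

sublists : ∀ {X : Set} → List X → List (List X)
sublists []       = [] ∷ []
sublists (x ∷ xs) = map (x ∷_) (sublists xs) ++ sublists xs

filter∈sublists : ∀ {X : Set} {P : X → Set} (P? : ∀ x → Dec (P x)) xs → filter P? xs ∈ˡ sublists xs
filter∈sublists P? [] = here refl
filter∈sublists P? (x ∷ xs) with P? x
... | yes _ = ∈-++⁺ˡ (∈-map⁺ (x ∷_) (filter∈sublists P? xs))
... | no  _ = ∈-++⁺ʳ (map (x ∷_) (sublists xs)) (filter∈sublists P? xs)

module _ {X : Set} where

  ∈⇒↭ : ∀ {x : X} {xs} → x ∈ˡ xs → ∃[ ys ] xs ↭ x ∷ ys
  ∈⇒↭ (here refl)           = _ , ↭-refl
  ∈⇒↭ {xs = y ∷ _} (there i) = let ys , π = ∈⇒↭ i in y ∷ ys , ↭-trans (prep y π) (swap y _ ↭-refl)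

  -- As `xs` has no repetitions, taking one of its members out of `zs` leaves the others there;
  -- membership thus already makes `xs` a submultiset.
  complement : ∀ {xs} (zs : List X) → Unique xs → (∀ {x} → x ∈ˡ xs → x ∈ˡ zs) → ∃[ ys ] zs ↭ ys ++ xs
  complement zs [] _ = zs , ↭-reflexive (sym (++-identityʳ zs))
  complement {x ∷ xs} zs (x∉ ∷ u) ⊆zs =
    let zs′ , π = ∈⇒↭ (⊆zs (here refl))
        ys  , ρ = complement zs′ u λ i → other (λ { refl → All¬⇒¬Any x∉ i }) (∈-resp-↭ π (⊆zs (there i)))
    in ys , ↭-trans π (↭-trans (prep x ρ) (↭-sym (shift x ys xs)))
    where
      other : ∀ {y zs′} → y ≢ x → y ∈ˡ x ∷ zs′ → y ∈ˡ zs′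
      other y≢x (here e)  = ⊥-elim (y≢x e)
      other y≢x (there i) = i

  choose : ∀ {P Q : X → Set} → ∀ {xs} → All (λ x → P x ⊎ Q x) xs →
           All P xs ⊎ ∃[ x ] ∃[ ys ] (xs ↭ x ∷ ys × Q x)
  choose [] = inj₁ []
  choose (inj₂ q ∷ _) = inj₂ (_ , _ , ↭-refl , q)
  choose (inj₁ p ∷ rs) with choose rs
  ... | inj₁ ps = inj₁ (p ∷ ps)
  ... | inj₂ (y , ys , π , q) = inj₂ (y , _ , ↭-trans (prep _ π) (swap _ y ↭-refl) , q)

module _ {X : Set} where

  misses : {P : X → Set} → (∀ x → Dec (P x)) → List X → ℕ
  misses P? [] = 0
  misses P? (x ∷ xs) with P? x
  ... | yes _ = misses P? xs
  ... | no _  = suc (misses P? xs)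

  module _ {P P′ : X → Set} (P? : ∀ x → Dec (P x)) (P′? : ∀ x → Dec (P′ x)) (P⊆P′ : ∀ {x} → P x → P′ x) where

    misses-≤ : ∀ xs → misses P′? xs ≤ misses P? xs
    misses-≤ [] = z≤n
    misses-≤ (x ∷ xs) with P′? x | P? x
    ... | yes _ | yes _ = misses-≤ xs
    ... | yes _ | no _  = m≤n⇒m≤1+n (misses-≤ xs)
    ... | no ¬p | yes p = ⊥-elim (¬p (P⊆P′ p))
    ... | no _  | no _  = s≤s (misses-≤ xs)

    misses-< : ∀ {x xs} → x ∈ˡ xs → ¬ P x → P′ x → misses P′? xs < misses P? xs
    misses-< {xs = y ∷ xs} i ¬p p′ with P′? y | P? y | i
    ... | yes _ | no _  | _         = s≤s (misses-≤ xs)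
    ... | no ¬q | yes q | _         = ⊥-elim (¬q (P⊆P′ q))
    ... | no ¬q | no _  | here refl = ⊥-elim (¬q p′)
    ... | yes _ | yes q | here refl = ⊥-elim (¬p q)
    ... | yes _ | yes _ | there j   = misses-< j ¬p p′
    ... | no _  | no _  | there j   = s≤s (misses-< j ¬p p′)

-- There is no rule for ⊥ on the right, so it stays among the literals, as nothing.
literal : Maybe ℕ → Formula
literal = maybe′ atom ⊥ᶠ

-- L and R are still to be decomposed; the boxes in □ B have been unfolded by refl.
record State : Set where
  field
    L R : List Formula
    P   : List ℕ
    Q   : List (Maybe ℕ)
    B Σ : List Formula

  sequent : Sequent
  sequent = L ++ (map atom P ++ map □_ B) ⇒ R ++ (map literal Q ++ map □_ Σ)

  measure : ℕ
  measure = weights L + (weights R + sum (map (suc ∘ weight) Σ))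

open State

-- A formula in B is required only of the proper successors of w: it was put in L
-- when its box was unfolded.
record RefutesState (st : State) (w : World) : Set where
  constructor refuting
  field
    onL : All (w ⊩_) (L st)
    onP : All (λ p → w ⊩ atom p) (P st)
    onB : All (λ A → All (_⊩ □ A) (children w)) (B st)
    onR : All (w ⊮_) (R st)
    onQ : All (λ q → w ⊮ literal q) (Q st)
    onΣ : All (λ A → w ⊮ □ A) (Σ st)

Outcome : List Key → State → Set
Outcome H st = Der H (sequent st) ⊎ ∃[ w ] RefutesState st w

-- The countermodels of the right premises, one for each formula of `Σ`, become the children of a
-- single new world.
saturatedWorld : ∀ {Π Σ} → All (λ A → ∃[ w ] Refutes w (premise (Π , A))) Σ →
  ∃[ ws ] (All (λ w → All (w ⊩_) (map □_ Π)) ws × All (λ A → Any (_⊮ A) ws) Σ)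
saturatedWorld [] = [] , [] , []
saturatedWorld ((w , bs , (¬a ∷ [])) ∷ rs) =
  let ws , f , g = saturatedWorld rs in
  w ∷ ws , bs ∷ f , here ¬a ∷ All.map there g

-- Search over a finite closed set of formulas

module Search (U : List Formula) (U! : Unique U) (U-closed : Closed U) where

  keys : List Key
  keys = cartesianProduct (sublists U) U

  _seen?_ : ∀ k H → Dec (k ∈ˡ H)
  _seen?_ = member? _≟ᵏ_

  unseen : List Key → ℕ
  unseen H = misses (_seen? H) keys

  -- Entering a new right premise uses up one of finitely many keys; this drives the outer induction
  -- of the search.
  unseen-∷ : ∀ {k H} → k ∈ˡ keys → ¬ k ∈ˡ H → unseen (k ∷ H) < unseen H
  unseen-∷ {k} {H} i k∉H = misses-< (_seen? H) (_seen? (k ∷ H)) there i k∉H (here refl)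

  record Within (st : State) : Set where
    constructor within
    field
      inL : All (_∈ˡ U) (L st)
      inR : All (_∈ˡ U) (R st)
      inB : All (λ A → □ A ∈ˡ U) (B st)
      inΣ : All (_∈ˡ U) (Σ st)

  -- Filtering `U` by membership in `B` gives a canonical list: it ignores order and repetitions in
  -- `B` and lies among `sublists U`. Hence keys are finitely many and are compared by plain
  -- equality.
  opened : List Formula → List Formula
  opened B = filter (λ A → member? _≟ᶠ_ A B) U


  opened-⊆ : ∀ B {A} → A ∈ˡ opened B → A ∈ˡ B
  opened-⊆ B i = proj₂ (∈-filter⁻ (λ A → member? _≟ᶠ_ A B) {xs = U} i)

  module Saturated
    {H : List Key} {P : List ℕ} {Q : List (Maybe ℕ)} {B Σ : List Formula}
    (inB : All (λ A → □ A ∈ˡ U) B) where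

    st : State
    st = record { L = [] ; R = [] ; P = P ; Q = Q ; B = B ; Σ = Σ }

    Π : List Formula
    Π = opened B

    -- Literals do not depend on the children of a world, so the childless `world P []` stands in
    -- until the children are found.
    clash? : ∀ q → (world P [] ⊮ literal q) ⊎ ∃[ p ] (p ∈ˡ P × q ≡ just p)
    clash? nothing = inj₁ λ ()
    clash? (just p) with member? _≟_ p P
    ... | yes i = inj₂ (p , i , refl)
    ... | no ∉  = inj₁ ∉

    literal-false : ∀ ws q → world P [] ⊮ literal q → world P ws ⊮ literal q
    literal-false ws nothing  f = f
    literal-false ws (just _) f = f

    initial : ∀ {p Q′} → p ∈ˡ P → Q ↭ just p ∷ Q′ → Der H (sequent st)
    initial {p} i ρ = ax p
      (++⁺ʳ (map □_ B) (↭-map⁺ atom (proj₂ (∈⇒↭ i))) , ++⁺ʳ (map □_ Σ) (↭-map⁺ literal ρ))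

    -- The boxes of `B` split into `□ Π` and surplus copies; the latter go into the side context
    -- that the right premise discards.
    by-box : ∀ {A Σ′} → Σ ↭ A ∷ Σ′ →
             (Π , A) ∈ˡ H ⊎ Der ((Π , A) ∷ H) (premise (Π , A)) →
             Der H (sequent record st { R = A ∷ [] ; Σ = Σ′ }) → Der H (sequent st)
    by-box {A} {Σ′} ρ why d = [ (λ i → back shape main i) , box shape main ]′ why
      where
        G : ∃[ G ] B ↭ G ++ Π
        G = complement B (Unique.filter⁺ (λ A → member? _≟ᶠ_ A B) U!) (opened-⊆ B)

        Γ : List Formula
        Γ = map atom P ++ map □_ (proj₁ G)

        split : map atom P ++ map □_ B ↭ Γ ++ map □_ Π
        split = ↭-trans (++⁺ˡ (map atom P) (↭-map⁺ □_ (proj₂ G))) (↭-reflexive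
          (trans (cong (map atom P ++_) (map-++ □_ (proj₁ G) Π)) (sym (++-assoc (map atom P) _ _))))

        shape : sequent st ≋ (Γ ++ map □_ Π ⇒ □ A ∷ (map literal Q ++ map □_ Σ′))
        shape = split , ↭-trans (++⁺ˡ (map literal Q) (↭-map⁺ □_ ρ)) (shift (□ A) (map literal Q) _)

        main : Der H (Γ ++ map □_ Π ⇒ A ∷ (map literal Q ++ map □_ Σ′))
        main = exchange (↭-sym split , ↭-refl) d

    -- The new world makes exactly the atoms of `P` true. Its children force the boxes of `B`
    -- because every formula of `B` reappears in `Π`, and each `A` in `Σ` fails at some child, so
    -- `□ A` fails at the root.
    countermodel : All (λ q → world P [] ⊮ literal q) Q →
                   All (λ A → ∃[ w ] Refutes w (premise (Π , A))) Σ → ∃[ w ] RefutesState st w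
    countermodel fQ fΣ with saturatedWorld fΣ
    ... | ws , keep , fail = world P ws , refuting []
      (All.tabulate λ i → i)
      (All.tabulate λ {A} i → All.map
        (λ bs → All.lookup bs (∈-map⁺ □_ (∈-filter⁺ (λ A → member? _≟ᶠ_ A B) (U-closed .nec (All.lookup inB i)) i))) keep)
      []
      (All.map (λ {q} → literal-false ws q) fQ)
      (All.map (λ f b → All¬⇒¬Any (All.map (λ b′ ¬a → ¬a (box⇒ b′)) (box⇒children b)) f) fail)

  start : List Formula → Formula → State
  start Π A = record { L = map □_ Π ; R = A ∷ [] ; P = [] ; Q = [] ; B = [] ; Σ = [] }

  start-within : ∀ {A} B → All (λ A → □ A ∈ˡ U) B → A ∈ˡ U → Within (start (opened B) A)
  start-within B inB a = within (map⁺ (All.tabulate λ i → All.lookup inB (opened-⊆ B i))) (a ∷ []) [] []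

  start-outcome : ∀ {H Π A} → Outcome H (start Π A) →
                  Der H (premise (Π , A)) ⊎ ∃[ w ] Refutes w (premise (Π , A))
  start-outcome (inj₁ d) = inj₁ (exchange (↭-reflexive (sym (++-identityʳ _)) , ↭-refl) d)
  start-outcome (inj₂ (w , refuting l _ _ r _ _)) = inj₂ (w , l , r)

  -- The second argument is invertibility of the step: a countermodel of the premise refutes the
  -- conclusion, so the search never backtracks.
  reduce₁ : ∀ {H st st′} → (Der H (sequent st′) → Der H (sequent st)) →
            (∀ {w} → RefutesState st′ w → RefutesState st w) → Outcome H st′ → Outcome H st
  reduce₁ f g (inj₁ d)       = inj₁ (f d)
  reduce₁ f g (inj₂ (w , r)) = inj₂ (w , g r)

  reduce₂ : ∀ {H st st₁ st₂} →
            (Der H (sequent st₁) → Der H (sequent st₂) → Der H (sequent st)) →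
            (∀ {w} → RefutesState st₁ w → RefutesState st w) →
            (∀ {w} → RefutesState st₂ w → RefutesState st w) →
            Outcome H st₁ → Outcome H st₂ → Outcome H st
  reduce₂ f g₁ g₂ (inj₂ (w , r)) _              = inj₂ (w , g₁ r)
  reduce₂ f g₁ g₂ (inj₁ _)       (inj₂ (w , r)) = inj₂ (w , g₂ r)
  reduce₂ f g₁ g₂ (inj₁ d)       (inj₁ d′)      = inj₁ (f d d′)

  rearrange₁ : ∀ l a r s → l + ((a + r) + s) ≡ (a + l) + (r + s)
  rearrange₁ = solve-∀

  rearrange₂ : ∀ a b r s → a + 0 + ((b + r) + s) ≡ ((a + b) + r) + s
  rearrange₂ = solve-∀

  rearrange₃ : ∀ a r s → r + (suc a + s) ≡ (suc a + r) + s
  rearrange₃ = solve-∀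

  -- The induction is lexicographic: `n` bounds the unseen keys and `k` the measure of the state.
  -- Local steps lower `k`; only a new right premise resets it, and that lowers `n`.
  search : ∀ n k H st → unseen H ≤ n → measure st < k → Within st → Outcome H st

  attempt : ∀ n H B A → unseen H ≤ n → All (λ A → □ A ∈ˡ U) B → A ∈ˡ U →
            let Π = opened B in
            (∃[ w ] Refutes w (premise (Π , A))) ⊎
            ((Π , A) ∈ˡ H ⊎ Der ((Π , A) ∷ H) (premise (Π , A)))

  search n (suc k) H st@(record { L = atom p ∷ L }) u (s≤s m) (within (_ ∷ l) r b s) =
    reduce₁ (exchange (↭-sym (shift _ L _) , ↭-refl))
      (λ { (refuting l (p ∷ ps) b r q s) → refuting (p ∷ l) ps b r q s })
      (search n k H (record st { L = L ; P = p ∷ P st }) u m (within l r b s))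
  search n (suc k) H (record { L = ⊥ᶠ ∷ L }) _ _ _ = inj₁ (bot ≋-refl)
  search n (suc k) H st@(record { L = (C ⊃ D) ∷ L }) u (s≤s m) (within (cd ∷ l) r b s) =
    reduce₂ (→L ≋-refl)
      (λ { (refuting (d ∷ l) p b r q s) → refuting ((λ _ → d) ∷ l) p b r q s })
      (λ { (refuting l p b (¬c ∷ r) q s) → refuting ((λ c → ⊥-elim (¬c c)) ∷ l) p b r q s })
      (search n k H (record st { L = D ∷ L }) u
        (≤-trans (s≤s (+-monoˡ-≤ _ (+-monoˡ-≤ (weights L) (m≤n+m (weight D) (weight C))))) m)
        (within (proj₂ (U-closed .imp cd) ∷ l) r b s))
      (search n k H (record st { L = L ; R = C ∷ R st }) u
        (≤-trans (s≤s (≤-trans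
          (≤-reflexive (rearrange₁ (weights L) (weight C) (weights (R st)) _))
          (+-monoˡ-≤ _ (+-monoˡ-≤ (weights L) (m≤m+n (weight C) (weight D)))))) m)
        (within l (proj₁ (U-closed .imp cd) ∷ r) b s))
  search n (suc k) H st@(record { L = (□ C) ∷ L }) u (s≤s m) (within (c ∷ l) r b s) =
    reduce₁
      (λ d → refl ≋-refl (exchange (prep C (↭-sym (↭-trans
        (++⁺ˡ L (shift (□ C) (map atom (P st)) _)) (shift (□ C) L _))) , ↭-refl) d))
      -- `C` at the world itself, from `L`, and `□ C` at its children, from `B`, together give
      -- `□ C`.
      (λ { {world _ _} (refuting (c ∷ l) p (cs ∷ b) r q s) → refuting (box c cs ∷ l) p b r q s })
      (search n k H (record st { L = C ∷ L ; B = C ∷ B st }) u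
        (≤-trans (n≤1+n _) m) (within (U-closed .nec c ∷ l) r (c ∷ b) s))
  search n (suc k) H st@(record { L = [] ; R = ⊥ᶠ ∷ R }) u (s≤s m) (within l (_ ∷ r) b s) =
    reduce₁ (exchange (↭-refl , ↭-sym (shift _ R _)))
      (λ { (refuting l p b r (q ∷ qs) s) → refuting l p b (q ∷ r) qs s })
      (search n k H (record st { R = R ; Q = nothing ∷ Q st }) u m (within l r b s))
  search n (suc k) H st@(record { L = [] ; R = atom p ∷ R }) u (s≤s m) (within l (_ ∷ r) b s) =
    reduce₁ (exchange (↭-refl , ↭-sym (shift _ R _)))
      (λ { (refuting l p b r (q ∷ qs) s) → refuting l p b (q ∷ r) qs s })
      (search n k H (record st { R = R ; Q = just p ∷ Q st }) u m (within l r b s))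
  search n (suc k) H st@(record { L = [] ; R = (C ⊃ D) ∷ R }) u (s≤s m) (within l (cd ∷ r) b s) =
    reduce₁ (→R ≋-refl)
      (λ { (refuting (c ∷ l) p b (¬d ∷ r) q s) → refuting l p b ((λ f → ¬d (f c)) ∷ r) q s })
      (search n k H (record st { L = C ∷ [] ; R = D ∷ R }) u
        (≤-trans (s≤s (≤-reflexive (rearrange₂ (weight C) (weight D) (weights R) _))) m)
        (within (proj₁ (U-closed .imp cd) ∷ []) (proj₂ (U-closed .imp cd) ∷ r) b s))
  search n (suc k) H st@(record { L = [] ; R = (□ C) ∷ R }) u (s≤s m) (within l (c ∷ r) b s) =
    reduce₁
      (exchange (↭-refl , ↭-sym (↭-trans
        (++⁺ˡ R (shift (□ C) (map literal (Q st)) _)) (shift (□ C) R _))))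
      (λ { (refuting l p b r q (c ∷ s)) → refuting l p b (c ∷ r) q s })
      (search n k H (record st { R = R ; Σ = C ∷ Σ st }) u
        (≤-trans (s≤s (≤-reflexive (rearrange₃ (weight C) (weights R) _))) m)
        (within l r b (U-closed .nec c ∷ s)))
  search n (suc k) H st@(record { L = [] ; R = [] ; Q = Q ; B = B ; Σ = Σ }) u (s≤s m) (within l r b s)
    with choose (All.universal (Saturated.clash? {H} {Q = Q} {Σ = Σ} b) Q)
  ... | inj₂ (_ , _ , ρ , _ , i , refl) = inj₁ (Saturated.initial b i ρ)
  -- The right premise is tried for every formula of `Σ`: either all of them are refuted and a
  -- countermodel is assembled, or one can be closed.
  ... | inj₁ fQ with choose (All.map (attempt n H B _ u b) s)
  ...   | inj₁ fΣ = inj₂ (Saturated.countermodel {H} b fQ fΣ)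
  -- The box rule is applied to an `A` whose right premise is derived or linked back; the search
  -- goes on with the left premise alone.
  ...   | inj₂ (A , Σ′ , ρ , why) =
    reduce₁ (Saturated.by-box b ρ why)
      -- By reflexivity, `A` failing at the world makes `□ A` fail there.
      (λ { (refuting l p b (¬a ∷ r) q s) → refuting l p b r q
             (All-resp-↭ (↭-sym ρ) ((λ a → ¬a (box⇒ a)) ∷ s)) })
      (search n k H (record st { R = A ∷ [] ; Σ = Σ′ }) u
        (≤-trans (s≤s (≤-reflexive (cong (_+ sum (map (suc ∘ weight) Σ′)) (+-identityʳ (weight A)))))
          (≤-trans (≤-reflexive (sym (sum-↭ (↭-map⁺ (suc ∘ weight) ρ)))) m))
        (within [] (All.head (All-resp-↭ ρ s) ∷ []) b (All.tail (All-resp-↭ ρ s))))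

  attempt n H B A u b a with (opened B , A) seen? H
  ... | yes i = inj₂ (inj₁ i)
  -- The strict drop in unseen keys below the bound `n` forces `n` to be a successor.
  ... | no ∉ with n | ≤-trans (unseen-∷ (∈-cartesianProduct⁺ (filter∈sublists (λ A → member? _≟ᶠ_ A B) U) a) ∉) u
  ...   | suc n′ | s≤s u′ with start-outcome (search n′ _ _ (start (opened B) A) u′ ≤-refl (start-within B b a))
  ...     | inj₁ d = inj₂ (inj₂ d)
  ...     | inj₂ r = inj₁ r

-- Completeness of the search and the cyclic proof

module _ (Γ Δ : List Formula) where

  -- Repetitions are removed so that `opened B` has none, as `complement` requires.
  universe : List Formula
  universe = deduplicate _≟ᶠ_ (concatMap subformulas (Γ ++ Δ))

  open Search universe (deduplicate-! _≟ᶠ_ _)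
    (closed-deduplicate (closed-concatMap (Γ ++ Δ)))

  completeness : Der [] (Γ ⇒ Δ) ⊎ ∃[ w ] Refutes w (Γ ⇒ Δ)
  completeness with search _ _ [] st ≤-refl ≤-refl
      (within (++⁻ˡ Γ inU) (++⁻ʳ Γ inU) [] [])
    where
      st : State
      st = record { L = Γ ; R = Δ ; P = [] ; Q = [] ; B = [] ; Σ = [] }
      inU : All (_∈ˡ universe) (Γ ++ Δ)
      inU = All.map (∈-deduplicate⁺ _≟ᶠ_) (⊆-concatMap (Γ ++ Δ))
  ... | inj₁ d = inj₁ (exchange
          (↭-reflexive (sym (++-identityʳ Γ)) , ↭-reflexive (sym (++-identityʳ Δ))) d)
  ... | inj₂ (w , refuting l _ _ r _ _) = inj₂ (w , l , r)

theorem8p5 : (Γ Δ : List Formula) → Provable (Γ ⇒ Δ) → CyclicProof (Γ ⇒ Δ)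
theorem8p5 Γ Δ π with completeness Γ Δ
... | inj₁ d       = Unravel.cyclic d
... | inj₂ (w , r) = ⊥-elim (soundness π w r)
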